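{- Let $T$ be a doubled graph in the class $\mathcal F$ that contains no antihole of length six. Then: (1) $T$ is either complete or has an even pair; (2) if $T$ is favorable, then $T$ has an even pair disjoint from its switchable component.
   Context: A trigraph $T$ consists of a finite set $V(T)$ and a map $\theta:\binom{V(T)}{2}\to\{ -1,0,1\}$. Distinct $u,v$ are strongly adjacent if $\theta(uv)=1$, strongly antiadjacent if $\theta(uv)=-1$, semiadjacent (a switchable pair) if $\theta(uv)=0$; adjacent if $\theta(uv)\in\{0,1\}$, antiadjacent if $\theta(uv)\in\{0,-1\}$. $N(v)$ is the set of vertices adjacent to $v$. The complement $\overline T$ has adjacency $-\theta$. $T|X$ is the restriction to $X$, $T\setminus X=T|(V(T)\setminus X)$; $T$ contains $H$ if $H$ is isomorphic to some $T|X$. A clique is a set of pairwise adjacent vertices; $T$ is complete if $V(T)$ is a clique. A component (anticomponent) of $X$ is a maximal subset of $X$ connected in the graph whose edges are the adjacent (antiadjacent) pairs. A good partition of $T$ is a partition $(X,Y)$ of $V(T)$ such that every component of $T|X$ and every anticomponent of $T|Y$ has at most two vertices, no switchable pair is between $X$ and $Y$, and for every component $C_x$ of $T|X$ and anticomponent $C_y$ of $T|Y$, every vertex of $C_x\cup C_y$ is incident with at most one strong edge and at most one strong antiedge between $C_x$ and $C_y$. $T$ is a doubled graph if it has a good partition. A path is a sequence $p_1,\dots,p_k$ of distinct vertices with $p_i,p_j$ adjacent when $|i-j|=1$ and antiadjacent when $|i-j|>1$; length $k-1$. A hole is a sequence $h_1,\dots,h_k$ ($k\ge5$) with cyclically consecutive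 vertices adjacent and other pairs antiadjacent; an antihole is an induced subtrigraph whose complement is a hole; its length is its number of vertices. $T$ is Berge if it has no odd hole and no odd antihole. An even pair is a strongly antiadjacent pair $\{u,v\}$ such that every path from $u$ to $v$ has even length. $\Sigma(T)$ is the graph on $V(T)$ whose edges are the switchable pairs; a switchable component is a component of $\Sigma(T)$ with at least two vertices. $\mathcal F$ is the class of Berge trigraphs with at most one switchable component, having at most two edges, such that if it has one edge $xy$ then $N(x)\cap N(y)=\emptyset$ (small), and if it has two edges $vx,vy$ then $v$ is strongly antiadjacent to all vertices outside $\{v,x,y\}$, $x,y$ are strongly antiadjacent and $N(x)\cap N(y)=\{v\}$ (light). $D$ denotes the vertex set of the switchable component ($\emptyset$ if none); a pair is disjoint from the switchable component if it does not meet $D$. $T\in\mathcal F$ is favorable if $|V(T)|\ge5$, $T$ has a strongly antiadjacent pair disjoint from $D$, and, if $D=\{x,y\}$ is small, at least one of $T\setminus(D\cup N(x))$, $T\setminus(D\cup N(y))$ is not a clique. -}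

module Defs where

open import Data.Nat using (ℕ; zero; suc; _*_; _≤_)
open import Data.Fin using (Fin; toℕ)
open import Data.Bool using (Bool; true; false)
open import Data.Product using (Σ; ∃; _×_; _,_)
open import Data.Sum using (_⊎_)
open import Data.Empty using (⊥)
open import Data.Unit using (⊤)
open import Relation.Nullary using (¬_)
open import Relation.Binary.PropositionalEquality using (_≡_; _≢_)
open import Function.Definitions using (Injective)

Even : ℕ → Set
Even k = ∃ λ m → k ≡ 2 * m

Odd : ℕ → Set
Odd k = ∃ λ m → k ≡ suc (2 * m)

-- Trigraphs on vertex set Fin n.
-- θ is a symmetric map on pairs; its value on the diagonal is irrelevant
-- (every notion below only looks at distinct pairs).

data Tri : Set where
  plus  : Tri
  semi  : Tri
  minus : Tri

neg : Tri → Tri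
neg plus  = minus
neg semi  = semi
neg minus = plus

record Trigraph (n : ℕ) : Set where
  field
    θ   : Fin n → Fin n → Tri
    sym : ∀ u v → θ u v ≡ θ v u
open Trigraph public

module _ {n : ℕ} (T : Trigraph n) where

  StrongAdj : Fin n → Fin n → Set
  StrongAdj u v = u ≢ v × θ T u v ≡ plus

  StrongAnti : Fin n → Fin n → Set
  StrongAnti u v = u ≢ v × θ T u v ≡ minus

  Switchable : Fin n → Fin n → Set
  Switchable u v = u ≢ v × θ T u v ≡ semi

  Adj : Fin n → Fin n → Set
  Adj u v = u ≢ v × (θ T u v ≡ plus ⊎ θ T u v ≡ semi)

  Anti : Fin n → Fin n → Set
  Anti u v = u ≢ v × (θ T u v ≡ semi ⊎ θ T u v ≡ minus)

  Complete : Set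
  Complete = ∀ u v → u ≢ v → Adj u v

  IsClique : (Fin n → Set) → Set
  IsClique S = ∀ u v → S u → S v → u ≢ v → Adj u v

  record Path (u v : Fin n) : Set where
    field
      len  : ℕ
      p    : Fin (suc len) → Fin n
      inj  : Injective _≡_ _≡_ p
      src  : p Data.Fin.zero ≡ u
      tgt  : p (Data.Fin.fromℕ len) ≡ v
      cons : ∀ i j → toℕ j ≡ suc (toℕ i) → Adj (p i) (p j)
      far  : ∀ i j → suc (toℕ i) Data.Nat.< toℕ j → Anti (p i) (p j)

  EvenPair : Fin n → Fin n → Set
  EvenPair u v = StrongAnti u v × (∀ (P : Path u v) → Even (Path.len P))

CycCons : (k : ℕ) → Fin k → Fin k → Set
CycCons k i j =
  toℕ j ≡ suc (toℕ i) ⊎ toℕ i ≡ suc (toℕ j)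
  ⊎ (toℕ i ≡ 0 × suc (toℕ j) ≡ k) ⊎ (toℕ j ≡ 0 × suc (toℕ i) ≡ k)

complement : ∀ {n} → Trigraph n → Trigraph n
complement T = record { θ = λ u v → neg (θ T u v) ; sym = λ u v → Relation.Binary.PropositionalEquality.cong neg (sym T u v) }
  where open import Relation.Binary.PropositionalEquality using (cong)

Hole : ∀ {n} → Trigraph n → ℕ → Set
Hole {n} T k = 5 ≤ k × Σ (Fin k → Fin n) λ h →
  Injective _≡_ _≡_ h ×
  (∀ i j → i ≢ j → (CycCons k i j → Adj T (h i) (h j)) × (¬ CycCons k i j → Anti T (h i) (h j)))

Antihole : ∀ {n} → Trigraph n → ℕ → Set
Antihole T k = Hole (complement T) k

Berge : ∀ {n} → Trigraph n → Set
Berge T = ∀ k → Odd k → ¬ Hole T k × ¬ Antihole T k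

data Reach {n : ℕ} (S : Fin n → Set) (R : Fin n → Fin n → Set) (a : Fin n) : Fin n → Set where
  here : S a → Reach S R a a
  step : ∀ {b c} → Reach S R a b → S c → R b c → Reach S R a c

module _ {n : ℕ} (T : Trigraph n) where

  GoodPartition : (Fin n → Bool) → Set
  GoodPartition inX =
    (∀ x → X x → ∀ a b c → Cx x a → Cx x b → Cx x c → a ≡ b ⊎ a ≡ c ⊎ b ≡ c)
    × (∀ y → Y y → ∀ a b c → Cy y a → Cy y b → Cy y c → a ≡ b ⊎ a ≡ c ⊎ b ≡ c)
    × (∀ a b → X a → Y b → θ T a b ≢ semi)
    × (∀ x y → X x → Y y →
        (∀ a → Cx x a → ∀ b b' → Cy y b → Cy y b' →
           (StrongAdj T a b → StrongAdj T a b' → b ≡ b') ×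
           (StrongAnti T a b → StrongAnti T a b' → b ≡ b'))
        × (∀ b → Cy y b → ∀ a a' → Cx x a → Cx x a' →
           (StrongAdj T a b → StrongAdj T a' b → a ≡ a') ×
           (StrongAnti T a b → StrongAnti T a' b → a ≡ a')))
    where
      X : Fin n → Set
      X v = inX v ≡ true
      Y : Fin n → Set
      Y v = inX v ≡ false
      Cx : Fin n → Fin n → Set
      Cx x = Reach X (Adj T) x
      Cy : Fin n → Fin n → Set
      Cy y = Reach Y (Anti T) y

  Doubled : Set
  Doubled = Σ (Fin n → Bool) GoodPartition

  SamePair : Fin n → Fin n → Fin n → Fin n → Set
  SamePair u w x y = (u ≡ x × w ≡ y) ⊎ (u ≡ y × w ≡ x)

  -- The switchable structure of a trigraph with at most one switchable component,
  -- that component having at most two edges, and being small or light.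
  data SwitchShape : Set where
    noSwitch : (∀ u w → ¬ Switchable T u w) → SwitchShape
    small : (x y : Fin n) → Switchable T x y
          → (∀ u w → Switchable T u w → SamePair u w x y)
          → (∀ z → Adj T x z → Adj T y z → ⊥)
          → SwitchShape
    light : (v x y : Fin n) → x ≢ y → Switchable T v x → Switchable T v y
          → (∀ u w → Switchable T u w → SamePair u w v x ⊎ SamePair u w v y)
          → (∀ z → z ≢ v → z ≢ x → z ≢ y → StrongAnti T v z)
          → StrongAnti T x y
          → (∀ z → Adj T x z → Adj T y z → z ≡ v)
          → SwitchShape

  InF : Set
  InF = Berge T × SwitchShape

  InD : SwitchShape → Fin n → Set
  InD (noSwitch _) z = ⊥
  InD (small x y _ _ _) z = z ≡ x ⊎ z ≡ y
  InD (light v x y _ _ _ _ _ _ _) z = z ≡ v ⊎ z ≡ x ⊎ z ≡ y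

  SmallCond : SwitchShape → Set
  SmallCond (noSwitch _) = ⊤
  SmallCond s@(small x y _ _ _) =
    (¬ IsClique T (λ z → (¬ InD s z) × (¬ Adj T x z)))
    ⊎ (¬ IsClique T (λ z → (¬ InD s z) × (¬ Adj T y z)))
  SmallCond (light _ _ _ _ _ _ _ _ _ _) = ⊤

  Favorable : SwitchShape → Set
  Favorable s =
    5 ≤ n
    × (∃ λ u → ∃ λ v → StrongAnti T u v × (¬ InD s u) × (¬ InD s v))
    × SmallCond s

{-# OPTIONS --safe #-}
-- Let (X , Y) be a good partition.  Three kinds of strongly antiadjacent pairs
-- are always even:
--   * u , v in X with the same neighbours in Y;
--   * a in X and w in Y, if w has no antineighbour in Y, or if w is the only
--     vertex of Y that a misses;
--   * two vertices of Y, if X is strongly stable.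
-- An edge of X and two disjoint antiedges of Y form an antihole of length six.
-- So if X has an edge, Y has at most one antiedge, and the first two kinds
-- suffice.  If X is strongly stable, then either Y has a strong antiedge, or its
-- only antiedge is the switchable pair and the first two kinds suffice again.
-- For a favorable T with D inside Y, the condition N(x) ∩ N(y) = ∅ forces Y = D,
-- so two antiadjacent vertices missing x are both attached exactly to y.
module Submission where

open import Defs
open import Data.Nat using (ℕ; suc; _+_; _≤_; _<_; z≤n; s≤s)
import Data.Nat.Properties as ℕₚ
open import Data.Fin using (Fin; suc; toℕ; fromℕ)
open import Data.Fin.Patterns using (0F; 1F; 2F; 3F; 4F; 5F)
open import Data.Fin.Properties using (_≟_; any?; <-cmp; toℕ-fromℕ)
open import Data.Bool using (Bool; true; false)
import Data.Bool.Properties as Boolₚ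
open import Data.Product using (_×_; ∃; _,_; proj₁; proj₂; map₂)
open import Data.Sum using (_⊎_; inj₁; inj₂; [_,_]′; swap)
open import Data.Empty using (⊥; ⊥-elim)
open import Function using (_∘_)
open import Function.Definitions using (Injective)
open import Relation.Nullary using (¬_; Dec; yes; no; contradiction)
open import Relation.Nullary.Decidable using (True; False; toWitness; toWitnessFalse; _×-dec_; _⊎-dec_; ¬?; decidable-stable)
open import Relation.Binary using (tri<; tri≈; tri>)
open import Relation.Unary using (Decidable)
open import Relation.Binary.PropositionalEquality using (_≡_; _≢_; refl; trans; cong; subst; ≢-sym)
  renaming (sym to ≡-sym)

-- Decidable relations and elementary facts about trigraphs.

_≟ᵗ_ : (s t : Tri) → Dec (s ≡ t)
plus  ≟ᵗ plus  = yes refl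
plus  ≟ᵗ semi  = no λ ()
plus  ≟ᵗ minus = no λ ()
semi  ≟ᵗ plus  = no λ ()
semi  ≟ᵗ semi  = yes refl
semi  ≟ᵗ minus = no λ ()
minus ≟ᵗ plus  = no λ ()
minus ≟ᵗ semi  = no λ ()
minus ≟ᵗ minus = yes refl

cycCons? : ∀ k i j → Dec (CycCons k i j)
cycCons? k i j =
  (toℕ j ℕₚ.≟ suc (toℕ i)) ⊎-dec (toℕ i ℕₚ.≟ suc (toℕ j))
  ⊎-dec ((toℕ i ℕₚ.≟ 0) ×-dec (suc (toℕ j) ℕₚ.≟ k))
  ⊎-dec ((toℕ j ℕₚ.≟ 0) ×-dec (suc (toℕ i) ℕₚ.≟ k))

cycCons-sym : ∀ k i j → CycCons k i j → CycCons k j i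
cycCons-sym k i j (inj₁ e)               = inj₂ (inj₁ e)
cycCons-sym k i j (inj₂ (inj₁ e))        = inj₁ e
cycCons-sym k i j (inj₂ (inj₂ (inj₁ e))) = inj₂ (inj₂ (inj₂ e))
cycCons-sym k i j (inj₂ (inj₂ (inj₂ e))) = inj₂ (inj₂ (inj₁ e))

module _ {n : ℕ} (T : Trigraph n) where

  θ-sym : ∀ {u v t} → θ T u v ≡ t → θ T v u ≡ t
  θ-sym {u} {v} e = trans (sym T v u) e

  adj-sym : ∀ {u v} → Adj T u v → Adj T v u
  adj-sym (u≢v , inj₁ e) = ≢-sym u≢v , inj₁ (θ-sym e)
  adj-sym (u≢v , inj₂ e) = ≢-sym u≢v , inj₂ (θ-sym e)

  anti-sym : ∀ {u v} → Anti T u v → Anti T v u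
  anti-sym (u≢v , inj₁ e) = ≢-sym u≢v , inj₁ (θ-sym e)
  anti-sym (u≢v , inj₂ e) = ≢-sym u≢v , inj₂ (θ-sym e)

  strongAnti-sym : ∀ {u v} → StrongAnti T u v → StrongAnti T v u
  strongAnti-sym (u≢v , e) = ≢-sym u≢v , θ-sym e

  strongAnti⇒anti : ∀ {u v} → StrongAnti T u v → Anti T u v
  strongAnti⇒anti (u≢v , e) = u≢v , inj₂ e

  anti⇒≢plus : ∀ {u v} → Anti T u v → θ T u v ≢ plus
  anti⇒≢plus (_ , inj₁ e) e′ with () ← trans (≡-sym e) e′
  anti⇒≢plus (_ , inj₂ e) e′ with () ← trans (≡-sym e) e′

  adj⇒≢minus : ∀ {u v} → Adj T u v → θ T u v ≢ minus
  adj⇒≢minus (_ , inj₁ e) e′ with () ← trans (≡-sym e) e′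
  adj⇒≢minus (_ , inj₂ e) e′ with () ← trans (≡-sym e) e′

  ¬strongAnti⇒adj : ∀ {u v} → u ≢ v → ¬ StrongAnti T u v → Adj T u v
  ¬strongAnti⇒adj {u} {v} u≢v ¬s with θ T u v
  ... | plus  = u≢v , inj₁ refl
  ... | semi  = u≢v , inj₂ refl
  ... | minus = contradiction (u≢v , refl) ¬s

  ¬anti⇒plus : ∀ {u v} → u ≢ v → ¬ Anti T u v → θ T u v ≡ plus
  ¬anti⇒plus {u} {v} u≢v ¬a with θ T u v
  ... | plus  = refl
  ... | semi  = contradiction (u≢v , inj₁ refl) ¬a
  ... | minus = contradiction (u≢v , inj₂ refl) ¬a

  ¬adj⇒minus : ∀ {u v} → u ≢ v → ¬ Adj T u v → θ T u v ≡ minus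
  ¬adj⇒minus {u} {v} u≢v ¬a with θ T u v
  ... | plus  = contradiction (u≢v , inj₁ refl) ¬a
  ... | semi  = contradiction (u≢v , inj₂ refl) ¬a
  ... | minus = refl

  adj? : ∀ u v → Dec (Adj T u v)
  adj? u v = ¬? (u ≟ v) ×-dec ((θ T u v ≟ᵗ plus) ⊎-dec (θ T u v ≟ᵗ semi))

  anti? : ∀ u v → Dec (Anti T u v)
  anti? u v = ¬? (u ≟ v) ×-dec ((θ T u v ≟ᵗ semi) ⊎-dec (θ T u v ≟ᵗ minus))

  strongAnti? : ∀ u v → Dec (StrongAnti T u v)
  strongAnti? u v = ¬? (u ≟ v) ×-dec (θ T u v ≟ᵗ minus)

  clique⊎antipair : ∀ {S : Fin n → Set} → Decidable S →
    IsClique T S ⊎ (∃ λ u → ∃ λ v → S u × S v × StrongAnti T u v)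
  clique⊎antipair S? with any? (λ u → any? λ v → S? u ×-dec S? v ×-dec strongAnti? u v)
  ... | yes p = inj₂ p
  ... | no ¬p = inj₁ λ u v Su Sv u≢v →
    ¬strongAnti⇒adj u≢v λ s → ¬p (u , v , Su , Sv , s)

  far-tgt : ∀ {u v} (P : Path T u v) → let open Path P in
            ∀ i → suc (toℕ i) < len → Anti T (p i) v
  far-tgt P i i<l = subst (Anti T (p i)) tgt
    (far i (fromℕ len) (subst (suc (toℕ i) <_) (≡-sym (toℕ-fromℕ len)) i<l))
    where open Path P

  -- Lengths 0 and 1 contradict strong antiadjacency, and length 2 is even. The equation on `len`
  -- lets a caller match it with `refl` and so name the first four vertices of the path.
  long-paths-even⇒evenPair : ∀ {u v} → StrongAnti T u v →
    (∀ m (P : Path T u v) → Path.len P ≡ 3 + m → Even (3 + m)) → EvenPair T u v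
  long-paths-even⇒evenPair {u} {v} s@(u≢v , e) long = s , even
    where
    even : ∀ P → Even (Path.len P)
    even record { len = 0 ; src = src ; tgt = tgt } = contradiction (trans (≡-sym src) tgt) u≢v
    even record { len = 1 ; src = refl ; tgt = refl ; cons = cons } =
      contradiction e (adj⇒≢minus (cons 0F 1F refl))
    even record { len = 2 } = 1 , refl
    even P@record { len = suc (suc (suc m)) } = long m P refl

  -- Antiholes described by adjacency in `T` itself.

  record Linked (k : ℕ) (h : Fin k → Fin n) (i j : Fin k) : Set where
    constructor linked
    field
      consecutive : CycCons k i j → Anti T (h i) (h j)
      apart       : ¬ CycCons k i j → Adj T (h i) (h j)

  module _ {k : ℕ} {h : Fin k → Fin n} where

    open Linked

    -- The implicit decision is evaluated at closed indices, so cyclic positions are checked by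
    -- computation.
    linked-cons : ∀ {i j} {_ : True (cycCons? k i j)} → Anti T (h i) (h j) → Linked k h i j
    linked-cons {_} {_} {c} a = linked (λ _ → a) (contradiction (toWitness c))

    linked-apart : ∀ {i j} {_ : False (cycCons? k i j)} → Adj T (h i) (h j) → Linked k h i j
    linked-apart {_} {_} {c} a = linked (λ c′ → contradiction c′ (toWitnessFalse c)) (λ _ → a)

    linked-sym : ∀ {i j} → Linked k h i j → Linked k h j i
    linked-sym {i} {j} l = linked
      (anti-sym ∘ consecutive l ∘ cycCons-sym k j i)
      (λ ¬c → adj-sym (apart l (¬c ∘ cycCons-sym k i j)))

    linked⇒≢ : ∀ {i j} → Linked k h i j → h i ≢ h j
    linked⇒≢ {i} {j} l with cycCons? k i j
    ... | yes c = proj₁ (consecutive l c)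
    ... | no ¬c = proj₁ (apart l ¬c)

    -- Adjacency and antiadjacency both include distinctness, so injectivity of `h` comes for free.
    -- As `Linked` is symmetric, increasing pairs of indices suffice.
    linked⇒antihole : 5 ≤ k → (∀ i j → toℕ i < toℕ j → Linked k h i j) → Antihole T k
    linked⇒antihole 5≤k l =
      5≤k , h , inj , λ i j i≢j →
        neg-anti ∘ consecutive (links i j i≢j) , neg-adj ∘ apart (links i j i≢j)
      where
      links : ∀ i j → i ≢ j → Linked k h i j
      links i j i≢j with <-cmp i j
      ... | tri< i<j _ _ = l i j i<j
      ... | tri≈ _ i≡j _ = contradiction i≡j i≢j
      ... | tri> _ _ j<i = linked-sym (l j i j<i)
      inj : Injective _≡_ _≡_ h
      inj {i} {j} e = decidable-stable (i ≟ j) λ i≢j → linked⇒≢ (links i j i≢j) e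
      neg-anti : ∀ {u v} → Anti T u v → Adj (complement T) u v
      neg-anti (u≢v , e) = u≢v , swap ([ inj₁ ∘ cong neg , inj₂ ∘ cong neg ]′ e)
      neg-adj : ∀ {u v} → Adj T u v → Anti (complement T) u v
      neg-adj (u≢v , e) = u≢v , swap ([ inj₁ ∘ cong neg , inj₂ ∘ cong neg ]′ e)

-- Consequences of a good partition.

module GoodPartitionProperties {n : ℕ} (T : Trigraph n) (inX : Fin n → Bool)
                               (good : GoodPartition T inX) where

  X Y : Fin n → Set
  X v = inX v ≡ true
  Y v = inX v ≡ false

  X? : Decidable X
  X? v = inX v Boolₚ.≟ true

  Y? : Decidable Y
  Y? v = inX v Boolₚ.≟ false

  side : ∀ v → X v ⊎ Y v
  side v with inX v
  ... | true  = inj₁ refl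
  ... | false = inj₂ refl

  X≢Y : ∀ {a b} → X a → Y b → a ≢ b
  X≢Y Xa Yb refl with () ← trans (≡-sym Xa) Yb

  -- Otherwise the component of `a` would have three vertices. Thus the edges inside X form a
  -- matching, and dually so do the antiedges inside Y.
  X-neighbour-unique : ∀ {a b c} → X a → X b → X c → Adj T a b → Adj T a c → b ≡ c
  X-neighbour-unique {a} {b} {c} Xa Xb Xc ab ac
    with proj₁ good a Xa a b c (here Xa) (step (here Xa) Xb ab) (step (here Xa) Xc ac)
  ... | inj₁ a≡b        = contradiction a≡b (proj₁ ab)
  ... | inj₂ (inj₁ a≡c) = contradiction a≡c (proj₁ ac)
  ... | inj₂ (inj₂ b≡c) = b≡c

  Y-antineighbour-unique : ∀ {a b c} → Y a → Y b → Y c → Anti T a b → Anti T a c → b ≡ c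
  Y-antineighbour-unique {a} {b} {c} Ya Yb Yc ab ac
    with proj₁ (proj₂ good) a Ya a b c (here Ya) (step (here Ya) Yb ab) (step (here Ya) Yc ac)
  ... | inj₁ a≡b        = contradiction a≡b (proj₁ ab)
  ... | inj₂ (inj₁ a≡c) = contradiction a≡c (proj₁ ac)
  ... | inj₂ (inj₂ b≡c) = b≡c

  cross : ∀ {a b} → X a → Y b → θ T a b ≡ plus ⊎ θ T a b ≡ minus
  cross {a} {b} Xa Yb with θ T a b in eq
  ... | plus  = inj₁ refl
  ... | semi  = contradiction eq (proj₁ (proj₂ (proj₂ good)) a b Xa Yb)
  ... | minus = inj₂ refl

  cross-adj : ∀ {a b} → X a → Y b → Adj T a b → θ T a b ≡ plus
  cross-adj Xa Yb ab with cross Xa Yb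
  ... | inj₁ e = e
  ... | inj₂ e = contradiction e (adj⇒≢minus T ab)

  cross-anti : ∀ {a b} → X a → Y b → Anti T a b → θ T a b ≡ minus
  cross-anti Xa Yb ab with cross Xa Yb
  ... | inj₁ e = contradiction e (anti⇒≢plus T ab)
  ... | inj₂ e = e

  module _ {a a′ b} (Xa : X a) (Xa′ : X a′) (aa′ : Adj T a a′) (Yb : Y b) where

    private
      atMostOne = proj₂ (proj₂ (proj₂ (proj₂ good)) a b Xa Yb) b (here Yb) a a′
                    (here Xa) (step (here Xa) Xa′ aa′)

    -- At most one strong edge and one strong antiedge join `b` to the component of `a`, and no
    -- crossing pair is switchable; so `b` is adjacent to exactly one of `a`, `a′`. The dual
    -- argument serves an antiedge of Y.
    X-edge-minus⇒plus : θ T a b ≡ minus → θ T a′ b ≡ plus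
    X-edge-minus⇒plus e with cross Xa′ Yb
    ... | inj₁ e′ = e′
    ... | inj₂ e′ = contradiction (proj₂ atMostOne (X≢Y Xa Yb , e) (X≢Y Xa′ Yb , e′)) (proj₁ aa′)

    X-edge-plus⇒minus : θ T a b ≡ plus → θ T a′ b ≡ minus
    X-edge-plus⇒minus e with cross Xa′ Yb
    ... | inj₂ e′ = e′
    ... | inj₁ e′ = contradiction (proj₁ atMostOne (X≢Y Xa Yb , e) (X≢Y Xa′ Yb , e′)) (proj₁ aa′)

  module _ {a b b′} (Xa : X a) (Yb : Y b) (Yb′ : Y b′) (bb′ : Anti T b b′) where

    private
      atMostOne = proj₁ (proj₂ (proj₂ (proj₂ good)) a b Xa Yb) a (here Xa) b b′
                    (here Yb) (step (here Yb) Yb′ bb′)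

    Y-antiedge-minus⇒plus : θ T a b ≡ minus → θ T a b′ ≡ plus
    Y-antiedge-minus⇒plus e with cross Xa Yb′
    ... | inj₁ e′ = e′
    ... | inj₂ e′ = contradiction (proj₂ atMostOne (X≢Y Xa Yb , e) (X≢Y Xa Yb′ , e′)) (proj₁ bb′)

    Y-antiedge-plus⇒minus : θ T a b ≡ plus → θ T a b′ ≡ minus
    Y-antiedge-plus⇒minus e with cross Xa Yb′
    ... | inj₂ e′ = e′
    ... | inj₁ e′ = contradiction (proj₁ atMostOne (X≢Y Xa Yb , e) (X≢Y Xa Yb′ , e′)) (proj₁ bb′)

  -- Even pairs

  -- A path of length at least 3 must have length 4. Its second vertex lies in X, since a neighbour
  -- of `u` in Y would also be a neighbour of `v`; this edge of X then determines the sides of the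
  -- later vertices.
  twins-evenPair : ∀ {u v} → X u → X v → StrongAnti T u v →
    (∀ y → Y y → θ T u y ≡ θ T v y) → EvenPair T u v
  twins-evenPair {u} {v} Xu Xv s twin = long-paths-even⇒evenPair T s long
    where
    long : ∀ m (P : Path T u v) → Path.len P ≡ 3 + m → Even (3 + m)
    long m P@record { p = p ; inj = inj ; src = refl ; tgt = tgt ; cons = cons ; far = far } refl with side (p 1F)
    ... | inj₂ Y₁ = contradiction
      (θ-sym T (trans (≡-sym (twin _ Y₁)) (cross-adj Xu Y₁ (cons 0F 1F refl))))
      (anti⇒≢plus T (far-tgt T P 1F (s≤s (s≤s (s≤s z≤n)))))
    ... | inj₁ X₁ = rest m refl
      where
      p₀p₁ = cons 0F 1F refl
      -- A vertex antiadjacent to both ends of an edge of X cannot lie in Y.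
      later-in-X : ∀ i → 3 ≤ toℕ i → X (p i)
      later-in-X i 3≤i with side (p i)
      ... | inj₁ Xᵢ = Xᵢ
      ... | inj₂ Yᵢ = contradiction
        (X-edge-minus⇒plus Xu X₁ p₀p₁ Yᵢ
          (cross-anti Xu Yᵢ (far 0F i (ℕₚ.≤-trans (s≤s (s≤s z≤n)) 3≤i))))
        (anti⇒≢plus T (far 1F i 3≤i))
      Y₂ : Y (p 2F)
      Y₂ with side (p 2F)
      ... | inj₂ y = y
      ... | inj₁ X₂ with () ← inj (X-neighbour-unique X₁ Xu X₂ (adj-sym T p₀p₁) (cons 1F 2F refl))
      v-p₂ : θ T v (p 2F) ≡ minus
      v-p₂ = trans (≡-sym (twin _ Y₂)) (cross-anti Xu Y₂ (far 0F 2F (s≤s (s≤s z≤n))))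
      -- Length 3 would make `p 2F` a neighbour of `v`; length 5 or more would give `p 4F` two
      -- neighbours in X.
      rest : ∀ k → m ≡ k → Even (suc (suc (suc k)))
      rest 0 refl = contradiction (θ-sym T v-p₂)
        (adj⇒≢minus T (subst (Adj T (p 2F)) tgt (cons 2F 3F refl)))
      rest 1 refl = 2 , refl
      rest (suc (suc _)) refl
        with () ← inj (X-neighbour-unique (later-in-X 4F (s≤s (s≤s (s≤s z≤n))))
                         (later-in-X 3F (s≤s (s≤s (s≤s z≤n))))
                         (later-in-X 5F (s≤s (s≤s (s≤s z≤n))))
                         (adj-sym T (cons 3F 4F refl)) (cons 4F 5F refl))

  -- The last hypothesis says that w has no antineighbour in Y, or that w is the
  -- only vertex of Y to which a is antiadjacent.
  cross-evenPair : ∀ {a w} → X a → Y w → StrongAnti T a w →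
    (∀ b → Y b → Anti T b w → ∀ y → Y y → y ≢ w → θ T a y ≡ plus) → EvenPair T a w
  cross-evenPair {a} {w} Xa Yw s hyp = long-paths-even⇒evenPair T s long
    where
    long : ∀ m (P : Path T a w) → Path.len P ≡ 3 + m → Even (3 + m)
    long m P@record { p = p ; inj = inj ; src = refl ; tgt = tgt ; cons = cons ; far = far } refl with side (p 1F)
    ... | inj₁ X₁ = contradiction (X-edge-minus⇒plus Xa X₁ (cons 0F 1F refl) Yw (proj₂ s))
                      (anti⇒≢plus T (far-tgt T P 1F (s≤s (s≤s (s≤s z≤n)))))
    ... | inj₂ Y₁ = rest (side (p 3F)) m refl
      where
      p₁-w : Anti T (p 1F) w
      p₁-w = far-tgt T P 1F (s≤s (s≤s (s≤s z≤n)))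
      -- The antineighbour `p 1F` of `w` lies in Y, which leaves the case where `a` misses only `w`.
      complete : ∀ y → Y y → y ≢ w → θ T a y ≡ plus
      complete = hyp _ Y₁ p₁-w
      p₂≢w : p 2F ≢ w
      p₂≢w e with () ← inj (trans e (≡-sym tgt))
      X₂ : X (p 2F)
      X₂ with side (p 2F)
      ... | inj₁ x = x
      ... | inj₂ Y₂ = contradiction (complete _ Y₂ p₂≢w) (anti⇒≢plus T (far 0F 2F (s≤s (s≤s z≤n))))
      p₂-w : θ T (p 2F) w ≡ minus
      p₂-w = Y-antiedge-plus⇒minus X₂ Y₁ Yw p₁-w (cross-adj X₂ Y₁ (adj-sym T (cons 1F 2F refl)))
      -- In Y, `p 3F` would be `w`, which `p 2F` misses, or a neighbour of `a`. In X, it cannot be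
      -- the last vertex, and with length 5 or more both ends of the edge from `p 2F` to `p 3F`
      -- would miss `w`.
      rest : X (p 3F) ⊎ Y (p 3F) → ∀ k → m ≡ k → Even (suc (suc (suc k)))
      rest (inj₂ Y₃) k _ with p 3F ≟ w
      ... | yes e = contradiction p₂-w (adj⇒≢minus T (subst (Adj T (p 2F)) e (cons 2F 3F refl)))
      ... | no ne = contradiction (complete _ Y₃ ne) (anti⇒≢plus T (far 0F 3F (s≤s (s≤s z≤n))))
      rest (inj₁ X₃) 0 refl = contradiction tgt (X≢Y X₃ Yw)
      rest (inj₁ X₃) 1 refl = 2 , refl
      rest (inj₁ X₃) (suc (suc _)) refl =
        contradiction (X-edge-minus⇒plus X₂ X₃ (cons 2F 3F refl) Yw p₂-w)
          (anti⇒≢plus T (far-tgt T P 3F (s≤s (s≤s (s≤s (s≤s (s≤s z≤n)))))))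

  -- No path has length 3 or more: `p 1F` in Y would be a second antineighbour of `b′`, so `p 1F` is
  -- in X and, by stability, `p 2F` is in Y, where it would be a second antineighbour of `b`.
  X-stable⇒Y-evenPair : (∀ a a′ → X a → X a′ → ¬ Adj T a a′) →
    ∀ {b b′} → Y b → Y b′ → StrongAnti T b b′ → EvenPair T b b′
  X-stable⇒Y-evenPair stable {b} {b′} Yb Yb′ s = long-paths-even⇒evenPair T s long
    where
    b′b = anti-sym T (strongAnti⇒anti T s)
    long : ∀ m (P : Path T b b′) → Path.len P ≡ 3 + m → Even (3 + m)
    long m P@record { p = p ; inj = inj ; src = refl ; tgt = tgt ; cons = cons ; far = far } refl with side (p 1F) | side (p 2F)
    ... | inj₂ Y₁ | _ = contradiction
      (Y-antineighbour-unique Yb′ Yb Y₁ b′b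
        (anti-sym T (far-tgt T P 1F (s≤s (s≤s (s≤s z≤n))))))
      (proj₁ (cons 0F 1F refl))
    ... | inj₁ X₁ | inj₁ X₂ = contradiction (cons 1F 2F refl) (stable _ _ X₁ X₂)
    ... | inj₁ X₁ | inj₂ Y₂
      with () ← inj (trans (Y-antineighbour-unique Yb Y₂ Yb′ (far 0F 2F (s≤s (s≤s z≤n)))
                              (strongAnti⇒anti T s)) (≡-sym tgt))

  -- Antiedges of Y

  -- Only `c` is constrained, but reversing the second antiedge gives the same for `c′`, so any two
  -- antiedges of Y have the same ends.
  NoDisjointAntiedges : Set
  NoDisjointAntiedges = ∀ {b b′ c c′} → Y b → Y b′ → Y c → Y c′ →
    Anti T b b′ → Anti T c c′ → c ≡ b ⊎ c ≡ b′

  module _ {a a′} (Xa : X a) (Xa′ : X a′) (aa′ : Adj T a a′) where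

    private
      oriented-antihole : ∀ {b b′ c c′} → Y b → Y b′ → Y c → Y c′ →
        Anti T b b′ → Anti T c c′ → c ≢ b → c ≢ b′ →
        θ T a b ≡ plus → θ T a c ≡ plus → Antihole T 6
      oriented-antihole {b} {b′} {c} {c′} Yb Yb′ Yc Yc′ bb′ cc′ c≢b c≢b′ ab ac =
        linked⇒antihole T (s≤s (s≤s (s≤s (s≤s (s≤s z≤n))))) links
        where
        -- Consecutive vertices are antiadjacent: `a` misses `b′` and `c′`, while `a′` misses `b`
        -- and `c`.
        h : Fin 6 → Fin n
        h 0F = a
        h 1F = b′
        h 2F = b
        h 3F = a′
        h 4F = c
        h 5F = c′
        ab′ = Y-antiedge-plus⇒minus Xa Yb Yb′ bb′ ab
        ac′ = Y-antiedge-plus⇒minus Xa Yc Yc′ cc′ ac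
        adjacent : ∀ {u v} → X u → Y v → θ T u v ≡ plus → Adj T u v
        adjacent Xu Yv e = X≢Y Xu Yv , inj₁ e
        antiadjacent : ∀ {u v} → X u → Y v → θ T u v ≡ minus → Anti T u v
        antiadjacent Xu Yv e = X≢Y Xu Yv , inj₂ e
        c′≢b : c′ ≢ b
        c′≢b refl = c≢b′ (Y-antineighbour-unique Yb Yc Yb′ (anti-sym T cc′) bb′)
        c′≢b′ : c′ ≢ b′
        c′≢b′ refl = c≢b (Y-antineighbour-unique Yb′ Yc Yb (anti-sym T cc′) (anti-sym T bb′))
        -- By the matching property, `w` is the only antineighbour of `u` in Y.
        join : ∀ {u v w} → Y u → Y v → Y w → u ≢ v → Anti T u w → v ≢ w → Adj T u v
        join Yu Yv Yw u≢v uw v≢w =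
          u≢v , inj₁ (¬anti⇒plus T u≢v λ uv → v≢w (Y-antineighbour-unique Yu Yv Yw uv uw))
        links : ∀ i j → toℕ i < toℕ j → Linked T 6 h i j
        links 0F 1F _ = linked-cons T (antiadjacent Xa Yb′ ab′)
        links 0F 2F _ = linked-apart T (adjacent Xa Yb ab)
        links 0F 3F _ = linked-apart T aa′
        links 0F 4F _ = linked-apart T (adjacent Xa Yc ac)
        links 0F 5F _ = linked-cons T (antiadjacent Xa Yc′ ac′)
        links 1F 2F _ = linked-cons T (anti-sym T bb′)
        links 1F 3F _ = linked-apart T (adj-sym T (adjacent Xa′ Yb′ (X-edge-minus⇒plus Xa Xa′ aa′ Yb′ ab′)))
        links 1F 4F _ = linked-apart T (join Yb′ Yc Yb (≢-sym c≢b′) (anti-sym T bb′) c≢b)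
        links 1F 5F _ = linked-apart T (join Yb′ Yc′ Yb (≢-sym c′≢b′) (anti-sym T bb′) c′≢b)
        links 2F 3F _ = linked-cons T (anti-sym T (antiadjacent Xa′ Yb (X-edge-plus⇒minus Xa Xa′ aa′ Yb ab)))
        links 2F 4F _ = linked-apart T (join Yb Yc Yb′ (≢-sym c≢b) bb′ c≢b′)
        links 2F 5F _ = linked-apart T (join Yb Yc′ Yb′ (≢-sym c′≢b) bb′ c′≢b′)
        links 3F 4F _ = linked-cons T (antiadjacent Xa′ Yc (X-edge-plus⇒minus Xa Xa′ aa′ Yc ac))
        links 3F 5F _ = linked-apart T (adjacent Xa′ Yc′ (X-edge-minus⇒plus Xa Xa′ aa′ Yc′ ac′))
        links 4F 5F _ = linked-cons T cc′
        links (suc _) 0F ()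
        links 1F 1F (s≤s ())
        links (suc (suc _)) 1F (s≤s ())
        links 2F 2F (s≤s (s≤s ()))
        links (suc (suc (suc _))) 2F (s≤s (s≤s ()))
        links 3F 3F (s≤s (s≤s (s≤s ())))
        links (suc (suc (suc (suc _)))) 3F (s≤s (s≤s (s≤s ())))
        links 4F 4F (s≤s (s≤s (s≤s (s≤s ()))))
        links 5F 4F (s≤s (s≤s (s≤s (s≤s ()))))
        links 5F 5F (s≤s (s≤s (s≤s (s≤s (s≤s ())))))

    -- Exactly one end of each antiedge is adjacent to `a`. The four cases rename the ends, and
    -- exchange the antiedges if `a` misses `c`, so that this end comes first.
    X-edge⇒noDisjointAntiedges : ¬ Antihole T 6 → NoDisjointAntiedges
    X-edge⇒noDisjointAntiedges ¬ah {b} {b′} {c} {c′} Yb Yb′ Yc Yc′ bb′ cc′ =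
      decidable-stable ((c ≟ b) ⊎-dec (c ≟ b′)) λ ne → absurd (ne ∘ inj₁) (ne ∘ inj₂)
      where
      absurd : c ≢ b → c ≢ b′ → ⊥
      absurd c≢b c≢b′ with cross Xa Yb | cross Xa Yc
      ... | inj₁ ab | inj₁ ac = ¬ah (oriented-antihole Yb Yb′ Yc Yc′ bb′ cc′ c≢b c≢b′ ab ac)
      ... | inj₂ ab | inj₁ ac = ¬ah (oriented-antihole Yb′ Yb Yc Yc′ (anti-sym T bb′) cc′ c≢b′ c≢b
                                       (Y-antiedge-minus⇒plus Xa Yb Yb′ bb′ ab) ac)
      ... | inj₁ ab | inj₂ ac = ¬ah (oriented-antihole Yc′ Yc Yb Yb′ (anti-sym T cc′) bb′ b≢c′ (≢-sym c≢b)
                                       (Y-antiedge-minus⇒plus Xa Yc Yc′ cc′ ac) ab)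
        where
        b≢c′ : b ≢ c′
        b≢c′ refl = c≢b′ (Y-antineighbour-unique Yb Yc Yb′ (anti-sym T cc′) bb′)
      ... | inj₂ ab | inj₂ ac = ¬ah (oriented-antihole Yc′ Yc Yb′ Yb (anti-sym T cc′) (anti-sym T bb′)
                                       b′≢c′ (≢-sym c≢b′)
                                       (Y-antiedge-minus⇒plus Xa Yc Yc′ cc′ ac)
                                       (Y-antiedge-minus⇒plus Xa Yb Yb′ bb′ ab))
        where
        b′≢c′ : b′ ≢ c′
        b′≢c′ refl = c≢b (Y-antineighbour-unique Yb′ Yc Yb (anti-sym T cc′) (anti-sym T bb′))

  -- Even pairs when Y has at most one antiedge.

  module _ (noDisjoint : NoDisjointAntiedges) where

    -- The vertex `w` itself works unless `a` misses another `z` in Y and `w` has an antineighbour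
    -- `b` in Y. Then `z` works: it is not on the only antiedge `b w`, because `a` is adjacent to
    -- `b`.
    nonneighbour⇒evenPair : ∀ {a w} → X a → Y w → θ T a w ≡ minus →
      ∃ λ y → Y y × EvenPair T a y
    nonneighbour⇒evenPair {a} {w} Xa Yw aw
      with any? (λ z → Y? z ×-dec ¬? (z ≟ w) ×-dec (θ T a z ≟ᵗ minus))
         | any? (λ b → Y? b ×-dec anti? T b w)
    ... | no unique | _ = w , Yw , cross-evenPair Xa Yw (X≢Y Xa Yw , aw)
      λ _ _ _ y Yy y≢w → [ (λ e → e) , (λ e → contradiction (y , Yy , y≢w , e) unique) ]′ (cross Xa Yy)
    ... | yes _ | no isolated = w , Yw , cross-evenPair Xa Yw (X≢Y Xa Yw , aw)
      λ b Yb bw → contradiction (b , Yb , bw) isolated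
    ... | yes (z , Yz , z≢w , az) | yes (b , Yb , bw) = z , Yz , cross-evenPair Xa Yz (X≢Y Xa Yz , az)
      λ c Yc cz → [ (λ { refl → contradiction (trans (≡-sym (Y-antiedge-minus⇒plus Xa Yw Yb (anti-sym T bw) aw)) az) λ () })
                  , (λ e → contradiction e z≢w) ]′
                  (noDisjoint Yb Yw Yz Yc bw (anti-sym T cz))

    -- The disjunction keeps track of the position of the pair relative to the
    -- switchable component.
    X-antipair⇒evenPair : ∀ {u v} → X u → StrongAnti T u v →
      ∃ λ s → ∃ λ t → EvenPair T s t × (s ≡ u ⊎ s ≡ v) × (Y t ⊎ t ≡ v)
    X-antipair⇒evenPair {u} {v} Xu uv
      with any? (λ w → Y? w ×-dec (θ T u w ≟ᵗ minus)) | side v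
    ... | yes (w , Yw , uw) | _ =
      let (y , Yy , even) = nonneighbour⇒evenPair Xu Yw uw in u , y , even , inj₁ refl , inj₁ Yy
    ... | no u-complete | inj₂ Yv = contradiction (v , Yv , proj₂ uv) u-complete
    ... | no u-complete | inj₁ Xv with any? (λ w → Y? w ×-dec (θ T v w ≟ᵗ minus))
    ...   | yes (w , Yw , vw) =
      let (y , Yy , even) = nonneighbour⇒evenPair Xv Yw vw in v , y , even , inj₂ refl , inj₁ Yy
    ...   | no v-complete = u , v , twins-evenPair Xu Xv uv same , inj₁ refl , inj₂ refl
      where
      same : ∀ y → Y y → θ T u y ≡ θ T v y
      same y Yy with cross Xu Yy | cross Xv Yy
      ... | inj₂ e | _      = contradiction (y , Yy , e) u-complete
      ... | _      | inj₂ e = contradiction (y , Yy , e) v-complete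
      ... | inj₁ e | inj₁ f = trans e (≡-sym f)

    antipair⇒evenPair : ∀ {u v} → X u ⊎ X v → StrongAnti T u v →
      ∃ λ s → ∃ λ t → EvenPair T s t × (s ≡ u ⊎ s ≡ v) × (Y t ⊎ t ≡ u ⊎ t ≡ v)
    antipair⇒evenPair (inj₁ Xu) uv =
      let (s , t , even , s∈ , t∈) = X-antipair⇒evenPair Xu uv
      in s , t , even , s∈ , [ inj₁ , inj₂ ∘ inj₂ ]′ t∈
    antipair⇒evenPair (inj₂ Xv) uv =
      let (s , t , even , s∈ , t∈) = X-antipair⇒evenPair Xv (strongAnti-sym T uv)
      in s , t , even , swap s∈ , [ inj₁ , inj₂ ∘ inj₁ ]′ t∈

  -- Switchable pairs, and an even pair from any strongly antiadjacent pair.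

  switchable-same-side : ∀ {u v} → Switchable T u v → (X u × X v) ⊎ (Y u × Y v)
  switchable-same-side {u} {v} (_ , e) with side u | side v
  ... | inj₁ Xu | inj₁ Xv = inj₁ (Xu , Xv)
  ... | inj₂ Yu | inj₂ Yv = inj₂ (Yu , Yv)
  ... | inj₁ Xu | inj₂ Yv = contradiction e (proj₁ (proj₂ (proj₂ good)) u v Xu Yv)
  ... | inj₂ Yu | inj₁ Xv = contradiction (θ-sym T e) (proj₁ (proj₂ (proj₂ good)) v u Xv Yu)

  -- A switchable pair is both an edge and an antiedge, so the matching property applies on either
  -- side. This excludes the light shape.
  switchable-functional : ∀ {v x y} → Switchable T v x → Switchable T v y → x ≡ y
  switchable-functional vx@(v≢x , e) vy@(v≢y , f)
    with switchable-same-side vx | switchable-same-side vy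
  ... | inj₁ (Xv , Xx) | inj₁ (_ , Xy) = X-neighbour-unique Xv Xx Xy (v≢x , inj₂ e) (v≢y , inj₂ f)
  ... | inj₂ (Yv , Yx) | inj₂ (_ , Yy) = Y-antineighbour-unique Yv Yx Yy (v≢x , inj₁ e) (v≢y , inj₁ f)
  ... | inj₁ (Xv , _)  | inj₂ (Yv , _) = contradiction refl (X≢Y Xv Yv)
  ... | inj₂ (Yv , _)  | inj₁ (Xv , _) = contradiction refl (X≢Y Xv Yv)

  -- The conclusion has the form of `NoDisjointAntiedges`, for use when every antiedge of Y is
  -- switchable.
  switchable-unique : SwitchShape T → ∀ {u v x y} → Switchable T u v → Switchable T x y →
    x ≡ u ⊎ x ≡ v
  switchable-unique (noSwitch none) uv _ = contradiction uv (none _ _)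
  switchable-unique (small _ _ _ only _) uv xy with only _ _ uv | only _ _ xy
  ... | inj₁ (refl , refl) | inj₁ (refl , refl) = inj₁ refl
  ... | inj₁ (refl , refl) | inj₂ (refl , refl) = inj₂ refl
  ... | inj₂ (refl , refl) | inj₁ (refl , refl) = inj₂ refl
  ... | inj₂ (refl , refl) | inj₂ (refl , refl) = inj₁ refl
  switchable-unique (light _ _ _ x≢y vx vy _ _ _ _) _ _ = contradiction (switchable-functional vx vy) x≢y

  antipair⇒∃evenPair : SwitchShape T → ¬ Antihole T 6 → ∀ {u v} → StrongAnti T u v →
    ∃ λ s → ∃ λ t → EvenPair T s t
  antipair⇒∃evenPair shape ¬ah {u} {v} uv
    with any? (λ a → any? λ a′ → X? a ×-dec X? a′ ×-dec adj? T a a′)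
       | any? (λ b → any? λ b′ → Y? b ×-dec Y? b′ ×-dec strongAnti? T b b′)
  ... | no stable | yes (b , b′ , Yb , Yb′ , bb′) =
    b , b′ , X-stable⇒Y-evenPair (λ a a′ Xa Xa′ aa′ → stable (a , a′ , Xa , Xa′ , aa′)) Yb Yb′ bb′
  ... | no _ | no noStrong =
    let (s , t , even , _) = antipair⇒evenPair noDisjoint meetsX uv in s , t , even
    where
    switchable : ∀ {b b′} → Y b → Y b′ → Anti T b b′ → Switchable T b b′
    switchable _  _   (b≢b′ , inj₁ e) = b≢b′ , e
    switchable Yb Yb′ (b≢b′ , inj₂ e) = contradiction (_ , _ , Yb , Yb′ , b≢b′ , e) noStrong
    noDisjoint : NoDisjointAntiedges
    noDisjoint Yb Yb′ Yc Yc′ bb′ cc′ =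
      switchable-unique shape (switchable Yb Yb′ bb′) (switchable Yc Yc′ cc′)
    meetsX : X u ⊎ X v
    meetsX with side u | side v
    ... | inj₁ Xu | _       = inj₁ Xu
    ... | _       | inj₁ Xv = inj₂ Xv
    ... | inj₂ Yu | inj₂ Yv = contradiction (u , v , Yu , Yv , uv) noStrong
  ... | yes (a , a′ , Xa , Xa′ , aa′) | _ = edge (side u) (side v)
    where
    noDisjoint : NoDisjointAntiedges
    noDisjoint = X-edge⇒noDisjointAntiedges Xa Xa′ aa′ ¬ah
    edge : X u ⊎ Y u → X v ⊎ Y v → ∃ λ s → ∃ λ t → EvenPair T s t
    edge (inj₁ Xu) _ = let (s , t , even , _) = antipair⇒evenPair noDisjoint (inj₁ Xu) uv in s , t , even
    edge _ (inj₁ Xv) = let (s , t , even , _) = antipair⇒evenPair noDisjoint (inj₂ Xv) uv in s , t , even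
    -- Exactly one end of the antiedge `u v` is missed by `a`, which supplies the nonneighbour.
    edge (inj₂ Yu) (inj₂ Yv) with cross Xa Yu
    ... | inj₂ au = a , map₂ proj₂ (nonneighbour⇒evenPair noDisjoint Xa Yu au)
    ... | inj₁ au = a , map₂ proj₂ (nonneighbour⇒evenPair noDisjoint Xa Yv
                      (Y-antiedge-plus⇒minus Xa Yu Yv (strongAnti⇒anti T uv) au))

  -- Even pairs avoiding a small switchable component.

  module _ {x y} (xy : Switchable T x y) (disjoint : ∀ z → Adj T x z → Adj T y z → ⊥)
           (¬ah : ¬ Antihole T 6) where

    -- The argument is symmetric in `x` and `y`, so one version serves both alternatives of
    -- `SmallCond`.
    small-evenPair : ¬ IsClique T (λ z → (¬ (z ≡ x ⊎ z ≡ y)) × (¬ Adj T x z)) →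
      ∃ λ u → ∃ λ v → EvenPair T u v × (¬ (u ≡ x ⊎ u ≡ y)) × (¬ (v ≡ x ⊎ v ≡ y))
    small-evenPair ¬clique
      with clique⊎antipair T (λ z → ¬? ((z ≟ x) ⊎-dec (z ≟ y)) ×-dec ¬? (adj? T x z))
    ... | inj₁ clique = contradiction clique ¬clique
    ... | inj₂ (u , v , (u∉D , ¬xu) , (v∉D , ¬xv) , uv) with switchable-same-side xy
    ...   | inj₁ (Xx , Xy) = s , t , even , s∉D , t∉D
      where
      misses : ∀ {z} → ¬ (z ≡ x ⊎ z ≡ y) → ¬ Adj T x z → θ T x z ≡ minus
      misses z∉D = ¬adj⇒minus T λ { refl → z∉D (inj₁ refl) }
      -- Both `u` and `v` are missed by `x`, which is adjacent to one end of every antiedge of Y.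
      meetsX : X u ⊎ X v
      meetsX with side u | side v
      ... | inj₁ Xu | _       = inj₁ Xu
      ... | _       | inj₁ Xv = inj₂ Xv
      ... | inj₂ Yu | inj₂ Yv = contradiction
        (trans (≡-sym (Y-antiedge-minus⇒plus Xx Yu Yv (strongAnti⇒anti T uv) (misses u∉D ¬xu)))
               (misses v∉D ¬xv)) λ ()
      found = antipair⇒evenPair
        (X-edge⇒noDisjointAntiedges Xx Xy (proj₁ xy , inj₂ (proj₂ xy)) ¬ah) meetsX uv
      s = proj₁ found
      t = proj₁ (proj₂ found)
      even = proj₁ (proj₂ (proj₂ found))
      s∉D : ¬ (s ≡ x ⊎ s ≡ y)
      s∉D with proj₁ (proj₂ (proj₂ (proj₂ found)))
      ... | inj₁ e = u∉D ∘ subst (λ z → z ≡ x ⊎ z ≡ y) e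
      ... | inj₂ e = v∉D ∘ subst (λ z → z ≡ x ⊎ z ≡ y) e
      -- An end in Y avoids the component because `x` and `y` lie in X.
      t∉D : ¬ (t ≡ x ⊎ t ≡ y)
      t∉D with proj₂ (proj₂ (proj₂ (proj₂ found)))
      ... | inj₁ Yt        = [ ≢-sym (X≢Y Xx Yt) , ≢-sym (X≢Y Xy Yt) ]′
      ... | inj₂ (inj₁ e) = u∉D ∘ subst (λ z → z ≡ x ⊎ z ≡ y) e
      ... | inj₂ (inj₂ e) = v∉D ∘ subst (λ z → z ≡ x ⊎ z ≡ y) e
    ...   | inj₂ (Yx , Yy) = u , v , twins-evenPair Xu Xv uv twin , u∉D , v∉D
      where
      x-y : Anti T x y
      x-y = proj₁ xy , inj₁ (proj₂ xy)
      -- The antiedge `x y` uses up the antineighbours of both ends in Y, so a third vertex of Y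
      -- would be a common neighbour.
      Y⊆D : ∀ {z} → Y z → z ≡ x ⊎ z ≡ y
      Y⊆D {z} Yz with z ≟ x | z ≟ y
      ... | yes e | _     = inj₁ e
      ... | _     | yes e = inj₂ e
      ... | no z≢x | no z≢y = ⊥-elim (disjoint z
        (≢-sym z≢x , inj₁ (¬anti⇒plus T (≢-sym z≢x) λ xz →
          z≢y (Y-antineighbour-unique Yx Yz Yy xz x-y)))
        (≢-sym z≢y , inj₁ (¬anti⇒plus T (≢-sym z≢y) λ yz →
          z≢x (Y-antineighbour-unique Yy Yz Yx yz (anti-sym T x-y)))))
      outside-in-X : ∀ {z} → ¬ (z ≡ x ⊎ z ≡ y) → X z
      outside-in-X {z} z∉D = [ (λ Xz → Xz) , (λ Yz → contradiction (Y⊆D Yz) z∉D) ]′ (side z)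
      Xu = outside-in-X u∉D
      Xv = outside-in-X v∉D
      misses : ∀ {z} → X z → ¬ Adj T x z → θ T z x ≡ minus
      misses Xz ¬xz = θ-sym T (¬adj⇒minus T (≢-sym (X≢Y Xz Yx)) ¬xz)
      twin : ∀ z → Y z → θ T u z ≡ θ T v z
      twin z Yz with Y⊆D Yz
      ... | inj₁ refl = trans (misses Xu ¬xu) (≡-sym (misses Xv ¬xv))
      ... | inj₂ refl = trans (Y-antiedge-minus⇒plus Xu Yx Yy x-y (misses Xu ¬xu))
                       (≡-sym (Y-antiedge-minus⇒plus Xv Yx Yy x-y (misses Xv ¬xv)))

theorem4p11 : ∀ {n} (T : Trigraph n) → Doubled T → Berge T → (s : SwitchShape T)
    → ¬ Antihole T 6
    → (Complete T ⊎ (∃ λ u → ∃ λ v → EvenPair T u v))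
    × (Favorable T s → ∃ λ u → ∃ λ v → EvenPair T u v × (¬ InD T s u) × (¬ InD T s v))
theorem4p11 {n} T (inX , good) _ shape ¬ah = complete⊎even , favorable shape
  where
  open GoodPartitionProperties T inX good

  complete⊎even : Complete T ⊎ (∃ λ u → ∃ λ v → EvenPair T u v)
  complete⊎even with any? (λ u → any? (strongAnti? T u))
  ... | yes (u , v , uv) = inj₂ (antipair⇒∃evenPair shape ¬ah uv)
  ... | no none = inj₁ λ u v u≢v → ¬strongAnti⇒adj T u≢v λ uv → none (u , v , uv)

  favorable : ∀ s → Favorable T s →
    ∃ λ u → ∃ λ v → EvenPair T u v × (¬ InD T s u) × (¬ InD T s v)
  favorable s@(noSwitch _) (_ , (_ , _ , uv , _) , _) =
    let (a , b , even) = antipair⇒∃evenPair s ¬ah uv in a , b , even , (λ ()) , (λ ())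
  favorable (small x y xy _ disjoint) (_ , _ , inj₁ ¬clique) = small-evenPair xy disjoint ¬ah ¬clique
  favorable (small x y (x≢y , xy) _ disjoint) (_ , _ , inj₂ ¬clique) =
    let (u , v , even , u∉D , v∉D) = small-evenPair (≢-sym x≢y , θ-sym T xy)
          (λ z yz xz → disjoint z xz yz) ¬ah
          (λ clique → ¬clique λ a b (a∉D , ¬ya) (b∉D , ¬yb) →
            clique a b (a∉D ∘ swap , ¬ya) (b∉D ∘ swap , ¬yb))
    in u , v , even , u∉D ∘ swap , v∉D ∘ swap
  favorable (light _ _ _ x≢y vx vy _ _ _ _) _ = contradiction (switchable-functional vx vy) x≢y
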